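{- For every integer $n\ge 1$, $$\mathrm{pf}_n(123,132,312)=\mathrm{pf}_n(123,213,231)=\mathrm{pf}_n(123,231,312)=\binom{n+1}{2}.$$
   Context: A Dyck path of semilength $n$ is a lattice path from $(0,0)$ to $(n,n)$ consisting of $n$ north steps $N=(0,1)$ and $n$ east steps $E=(1,0)$ that never goes below the line $y=x$. A parking function of size $n$ is a Dyck path of semilength $n$ whose $n$ north steps are labeled bijectively by $\{1,\dots,n\}$ so that whenever two north steps are consecutive in the path (one immediately following the other), the label of the later one is larger. For a parking function $p$ of size $n$, $\phi(p)$ is the permutation of $\{1,\dots,n\}$ (in one-line notation) obtained by reading the labels of the north steps in the order they occur along the path. A permutation $\pi$ of $\{1,\dots,n\}$ contains a permutation $\rho$ of $\{1,\dots,m\}$ if there are indices $1\le i_1<\cdots<i_m\le n$ such that $\pi_{i_a}\le\pi_{i_b}$ if and only if $\rho_a\le\rho_b$; otherwise $\pi$ avoids $\rho$. For permutations $\rho_1,\dots,\rho_r$, $\mathrm{pf}_n(\rho_1,\dots,\rho_r)$ denotes the number of parking functions $p$ of size $n$ such that $\phi(p)$ avoids each of $\rho_1,\dots,\rho_r$. -}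

module Defs where

open import Data.List.Base
  using (List; []; _∷_; [_]; _++_; map; length; lookup; filter; applyUpTo; inits; cartesianProductWith)
open import Data.List.Properties using (∷-injective)
open import Data.List.Membership.Propositional using (_∈_; _∉_)
open import Data.List.Membership.Propositional.Properties
  using (∈-∃++; ∈-map⁺; ∈-map⁻; ∈-filter⁺; ∈-filter⁻; ∈-cartesianProductWith⁺)
open import Data.List.Relation.Binary.Permutation.Propositional
  using (_↭_; ↭-refl; ↭-sym; ↭-trans; prep)
open import Data.List.Relation.Binary.Permutation.Propositional.Properties
  using (∈-resp-↭; ¬x∷xs↭[]; shift; drop-∷)
open import Data.List.Relation.Unary.All as All using (All; []; _∷_)
open import Data.List.Relation.Unary.Any using (here; there)
open import Data.List.Relation.Unary.AllPairs using ([]; _∷_)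
open import Data.List.Relation.Unary.Linked using (Linked; linked?)
open import Data.List.Relation.Unary.Unique.Propositional using (Unique)
import Data.List.Relation.Unary.Unique.Propositional.Properties as Unique
import Data.Vec.Relation.Unary.Linked as Vec
open import Data.Fin.Base as Fin using (Fin)
import Data.Fin.Properties as Fin
open import Data.Nat.Base using (ℕ; zero; suc; _+_; _≤_; _<_; s<s)
open import Data.Nat.Properties
  using (_≟_; _≤?_; _<?_; <⇒≢; +-suc)
open import Data.List.Membership.DecPropositional _≟_ using (_∈?_)
open import Data.Product.Base using (∃; _×_; _,_; proj₁; proj₂)
open import Data.Unit.Base using (⊤; tt)
open import Data.Vec.Base as Vec using (Vec; []; _∷_)
open import Function.Base using (_∘_)
open import Function.Bundles using (_⇔_; mk⇔; module Equivalence)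
open import Relation.Binary.Definitions as Binary using ()
open import Relation.Binary.PropositionalEquality
  using (_≡_; refl; sym; trans; cong; cong₂; subst)
open import Relation.Nullary.Decidable using (Dec; yes; no; map′; _×-dec_; _→-dec_; ¬?)
open import Relation.Nullary.Negation using (¬_)
open import Relation.Unary using (Decidable)

------------------------------------------------------------------------
-- Permutations in one-line notation

⟦1⋯_⟧ : ℕ → List ℕ
⟦1⋯ n ⟧ = applyUpTo suc n

IsPermutation : ℕ → List ℕ → Set
IsPermutation n π = π ↭ ⟦1⋯ n ⟧

SameOrder : (π ρ : List ℕ) → Vec (Fin (length π)) (length ρ) → Set
SameOrder π ρ i = ∀ a b →
  (lookup π (Vec.lookup i a) ≤ lookup π (Vec.lookup i b)) ⇔ (lookup ρ a ≤ lookup ρ b)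

-- The vector i lists the positions i₁ < ⋯ < iₘ of an occurrence of ρ in π.
_Contains_ : List ℕ → List ℕ → Set
π Contains ρ = ∃ λ (i : Vec (Fin (length π)) (length ρ)) →
  Vec.Linked Fin._<_ i × SameOrder π ρ i

_Avoids_ : List ℕ → List ℕ → Set
π Avoids ρ = ¬ (π Contains ρ)

------------------------------------------------------------------------
-- Parking functions as Dyck paths with labelled north steps

data Step : Set where
  N : (label : ℕ) → Step
  E : Step

#N : List Step → ℕ
#N []        = 0
#N (N _ ∷ p) = suc (#N p)
#N (E   ∷ p) = #N p

#E : List Step → ℕ
#E []        = 0
#E (N _ ∷ p) = #E p
#E (E   ∷ p) = suc (#E p)

-- An initial segment q of a path ends at the point (#E q , #N q).
IsDyckPath : ℕ → List Step → Set
IsDyckPath n p = #N p ≡ n × #E p ≡ n × All (λ q → #E q ≤ #N q) (inits p)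

φ : List Step → List ℕ
φ []        = []
φ (N ℓ ∷ p) = ℓ ∷ φ p
φ (E   ∷ p) = φ p

IncreasingNN : Step → Step → Set
IncreasingNN (N ℓ) (N ℓ′) = ℓ < ℓ′
IncreasingNN _     _      = ⊤

record IsParkingFunction (n : ℕ) (p : List Step) : Set where
  constructor isParkingFunction
  field
    dyckPath        : IsDyckPath n p
    bijectiveLabels : IsPermutation n (φ p)
    increasingRuns  : Linked IncreasingNN p

------------------------------------------------------------------------
-- Decidability

_↭?_ : Binary.Decidable (_↭_ {A = ℕ})
[]       ↭? []       = yes ↭-refl
[]       ↭? (y ∷ ys) = no (¬x∷xs↭[] ∘ ↭-sym)
(x ∷ xs) ↭? ys with x ∈? ys
... | no  x∉ys = no λ x∷xs↭ys → x∉ys (∈-resp-↭ x∷xs↭ys (here refl))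
... | yes x∈ys with ∈-∃++ x∈ys
...   | as , bs , refl = map′
  (λ eq → ↭-trans (prep x eq) (↭-sym (shift x as bs)))
  (λ eq → drop-∷ (↭-trans eq (shift x as bs)))
  (xs ↭? (as ++ bs))

isDyckPath? : ∀ n → Decidable (IsDyckPath n)
isDyckPath? n p =
  (#N p ≟ n) ×-dec (#E p ≟ n) ×-dec All.all? (λ q → #E q ≤? #N q) (inits p)

increasingNN? : Binary.Decidable IncreasingNN
increasingNN? (N ℓ) (N ℓ′) = ℓ <? ℓ′
increasingNN? (N _) E      = yes tt
increasingNN? E     _      = yes tt

isParkingFunction? : ∀ n → Decidable (IsParkingFunction n)
isParkingFunction? n p = map′
  (λ (d , b , i) → isParkingFunction d b i)
  (λ (isParkingFunction d b i) → d , b , i)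
  (isDyckPath? n p ×-dec (φ p ↭? ⟦1⋯ n ⟧) ×-dec linked? increasingNN? p)

anyVec? : ∀ {k m} {P : Vec (Fin k) m → Set} → Decidable P → Dec (∃ P)
anyVec? {m = zero}  P? = map′ ([] ,_) (λ { ([] , p) → p }) (P? [])
anyVec? {m = suc m} P? = map′
  (λ (i , is , p) → i ∷ is , p)
  (λ { (i ∷ is , p) → i , is , p })
  (Fin.any? λ i → anyVec? λ is → P? (i ∷ is))

infix 3 _⇔?_

_⇔?_ : {A B : Set} → Dec A → Dec B → Dec (A ⇔ B)
A? ⇔? B? = map′
  (λ (f , g) → mk⇔ f g)
  (λ e → Equivalence.to e , Equivalence.from e)
  ((A? →-dec B?) ×-dec (B? →-dec A?))

contains? : Binary.Decidable _Contains_
contains? π ρ = anyVec? λ i →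
  Vec.linked? Fin._<?_ i ×-dec
  Fin.all? (λ a → Fin.all? λ b →
    lookup π (Vec.lookup i a) ≤? lookup π (Vec.lookup i b) ⇔? lookup ρ a ≤? lookup ρ b)

avoids? : Binary.Decidable _Avoids_
avoids? π ρ = ¬? (contains? π ρ)

------------------------------------------------------------------------
-- Counting: parkingFunctions n lists every parking function of size n
-- exactly once (see ∈-parkingFunctions⇔ and parkingFunctions-unique).

words : {A : Set} → List A → ℕ → List (List A)
words as zero    = [ [] ]
words as (suc k) = cartesianProductWith _∷_ as (words as k)

steps : ℕ → List Step
steps n = E ∷ map N ⟦1⋯ n ⟧

parkingFunctions : ℕ → List (List Step)
parkingFunctions n = filter (isParkingFunction? n) (words (steps n) (n + n))

pf : ℕ → List (List ℕ) → ℕ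
pf n ρs = length (filter (λ p → All.all? (avoids? (φ p)) ρs) (parkingFunctions n))

------------------------------------------------------------------------
-- Correctness of the enumeration

∈-words : {A : Set} {as w : List A} → All (_∈ as) w → w ∈ words as (length w)
∈-words []           = here refl
∈-words (a∈as ∷ w⊆as) = ∈-cartesianProductWith⁺ _∷_ a∈as (∈-words w⊆as)

words-unique : {A : Set} {as : List A} → Unique as → ∀ k → Unique (words as k)
words-unique as! zero    = [] ∷ []
words-unique as! (suc k) =
  Unique.cartesianProductWith⁺ _∷_ ∷-injective as! (words-unique as! k)

length≡#N+#E : ∀ p → length p ≡ #N p + #E p
length≡#N+#E []        = refl
length≡#N+#E (N _ ∷ p) = cong suc (length≡#N+#E p)
length≡#N+#E (E   ∷ p) = trans (cong suc (length≡#N+#E p)) (sym (+-suc (#N p) (#E p)))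

∈-steps : ∀ {n} p → (∀ {ℓ} → ℓ ∈ φ p → ℓ ∈ ⟦1⋯ n ⟧) → All (_∈ steps n) p
∈-steps []        _ = []
∈-steps (N ℓ ∷ p) f = there (∈-map⁺ N (f (here refl))) ∷ ∈-steps p (f ∘ there)
∈-steps (E   ∷ p) f = here refl ∷ ∈-steps p f

steps-unique : ∀ n → Unique (steps n)
steps-unique n =
  All.tabulate (λ s∈ E≡s → E∉ (subst (_∈ map N ⟦1⋯ n ⟧) (sym E≡s) s∈)) ∷
  Unique.map⁺ (λ { refl → refl })
    (Unique.applyUpTo⁺₁ suc n (λ i<j _ → <⇒≢ (s<s i<j)))
  where
  E∉ : E ∉ map N ⟦1⋯ n ⟧
  E∉ E∈ with ∈-map⁻ N E∈
  ... | _ , _ , ()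

parkingFunctions-unique : ∀ n → Unique (parkingFunctions n)
parkingFunctions-unique n =
  Unique.filter⁺ (isParkingFunction? n) (words-unique (steps-unique n) (n + n))

∈-parkingFunctions⇔ : ∀ n p → (p ∈ parkingFunctions n) ⇔ IsParkingFunction n p
∈-parkingFunctions⇔ n p = mk⇔
  (λ p∈ → proj₂ (∈-filter⁻ (isParkingFunction? n) {xs = words (steps n) (n + n)} p∈))
  (λ p-pf → ∈-filter⁺ (isParkingFunction? n) (candidate p-pf) p-pf)
  where
  candidate : IsParkingFunction n p → p ∈ words (steps n) (n + n)
  candidate (isParkingFunction (#N≡n , #E≡n , _) labels _) =
    subst (λ k → p ∈ words (steps n) k)
      (trans (length≡#N+#E p) (cong₂ _+_ #N≡n #E≡n))
      (∈-words (∈-steps p (∈-resp-↭ labels)))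

{-# OPTIONS --safe #-}

-- The parking functions reading a permutation π are counted by the possible
-- positions of the east steps: one must follow every descent of π. If π is a
-- decreasing word α followed by a decreasing word β, with an ascent in between,
-- then exactly one east step is free, and it can follow the last entry of α or
-- any entry of β, which gives |β| + 1 parking functions. Each of the three avoidance
-- classes consists of n such permutations, which together attain each of the
-- counts 1, …, n exactly once.

module Submission where

open import Defs
open import Data.Bool.Base using (if_then_else_)
open import Data.Fin.Base as Fin using (Fin)
open import Data.Fin.Patterns using (0F; 1F; 2F)
open import Data.List.Base
  using (List; []; _∷_; [_]; _++_; map; length; lookup; filter; applyUpTo; applyDownFrom;
         upTo; inits; concatMap; take; drop)
open import Data.List.Properties
  using (∷-injectiveʳ; length-++; length-map; length-applyUpTo; length-applyDownFrom;
         applyUpTo-∷ʳ; map-upTo; map-∘; map-cong; map-cong-local;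
         length-take; length-drop; take++drop≡id; ++-identityʳ; ++-assoc;
         tabulate-lookup; reverse-applyDownFrom)
open import Data.List.Membership.Propositional using (_∈_; find)
open import Data.List.Membership.Propositional.Properties
open import Data.List.Membership.Propositional.Properties.WithK using (unique∧set⇒bag)
open import Data.List.Relation.Binary.BagAndSetEquality using (∼bag⇒↭)
open import Data.List.Relation.Binary.Disjoint.Propositional using (Disjoint)
open import Data.List.Relation.Binary.Permutation.Propositional
  using (_↭_; ↭-refl; ↭-sym; ↭-trans; ↭-reflexive; ↭-prep; ↭-swap; ↭⇒↭ₛ;
         module PermutationReasoning)
open import Data.List.Relation.Binary.Permutation.Propositional.Properties
  using (↭-length; ∈-resp-↭; All-resp-↭; drop-∷; ++-comm; ↭-reverse; ↭-singleton-inv)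
import Data.List.Relation.Binary.Permutation.Setoid.Properties as Permutation
open import Data.List.Relation.Unary.All as All using (All; []; _∷_)
import Data.List.Relation.Unary.All.Properties as All
open import Data.List.Relation.Unary.AllPairs as AllPairs using (AllPairs; []; _∷_)
import Data.List.Relation.Unary.AllPairs.Properties as AllPairs
open import Data.List.Relation.Unary.Any as Any using (here; there)
open import Data.List.Relation.Unary.Linked as Linked using (Linked; []; [-]; _∷_)
open import Data.List.Relation.Unary.Unique.Propositional using (Unique)
import Data.List.Relation.Unary.Unique.Propositional.Properties as Unique
open import Data.Nat.Base
  using (ℕ; zero; suc; _+_; _≤_; _<_; _≥_; _>_; z≤n; s≤s; z<s; s<s; s≤s⁻¹)
open import Data.Nat.Combinatorics using (_C_; nC1≡n; nCk+nC[k+1]≡[n+1]C[k+1])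
open import Data.Nat.ListAction using (sum)
open import Data.Nat.ListAction.Properties using (sum-++; sum-↭)
open import Data.Nat.Properties
open import Data.Product.Base using (_×_; _,_; proj₁; proj₂)
open import Data.Sum.Base using (_⊎_; inj₁; inj₂)
open import Data.Unit.Base using (tt)
open import Data.Vec.Base as Vec using (Vec; []; _∷_)
import Data.Vec.Relation.Unary.Linked as VecLinked
open import Function.Base using (_∘_)
open import Function.Bundles using (_⇔_; mk⇔; Equivalence)
open import Relation.Binary.Definitions using (tri<; tri≈; tri>)
open import Relation.Binary.PropositionalEquality
  using (_≡_; _≢_; refl; sym; trans; cong; cong₂; subst; subst₂; setoid; module ≡-Reasoning)
open import Relation.Nullary.Decidable using (yes; no; does)
open import Relation.Nullary.Negation using (¬_; contradiction)

-- Why the avoiders have this shape: 312, 132 and 123 are the three words obtained by inserting 3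
-- into 12, and 123, 213 and 231 those obtained by inserting 1 into 23. Take a permutation of 1 ...
-- n and its largest (or smallest) entry. An ascent among the other entries completes one of the
-- three patterns wherever the extreme entry stands, so the other entries must decrease and the
-- extreme one is free. For 123, 231 and 312 the patterns are rotations of one another: avoidance of
-- all three is invariant under rotation, and a cyclic arrangement is known once it is cut open at
-- its first entry. The obstacle in the count is that the next step depends on the height and on the
-- last step, so both are carried along. Descents keep a decreasing first run close to the diagonal,
-- and therefore only the heights 1 and 2 have to be solved.

-- Labelled paths with a prescribed reading word

-- Completion s h π p: from height h above the diagonal, just after the step s,
-- the path p ends on the diagonal without crossing it and reads the labels π.
data Completion : Step → ℕ → List ℕ → List Step → Set where
  done  : ∀ {s} → Completion s 0 [] []
  north : ∀ {s h x π p} → IncreasingNN s (N x) → Completion (N x) (suc h) π p →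
          Completion s h (x ∷ π) (N x ∷ p)
  east  : ∀ {s h π p} → Completion E h π p → Completion s (suc h) π (E ∷ p)

-- The recursion is lexicographic in (π, h): N consumes an entry and raises h, E keeps π and lowers
-- h. The last step s belongs to the state because a label is constrained only directly after
-- another N.
completions : Step → ℕ → List ℕ → List (List Step)
northFirst  : Step → ℕ → ℕ → List ℕ → List (List Step)

completions s zero    []      = [ [] ]
completions s (suc h) []      = map (E ∷_) (completions E h [])
completions s zero    (x ∷ π) = northFirst s zero x π
completions s (suc h) (x ∷ π) = northFirst s (suc h) x π ++ map (E ∷_) (completions E h (x ∷ π))

northFirst s h x π =
  if does (increasingNN? s (N x)) then map (N x ∷_) (completions (N x) (suc h) π) else []

∈-completions⁺ : ∀ {s h π p} → Completion s h π p → p ∈ completions s h π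
∈-northFirst⁺  : ∀ {s h x π p} → IncreasingNN s (N x) → Completion (N x) (suc h) π p →
                 N x ∷ p ∈ northFirst s h x π

∈-completions⁺ done                          = here refl
∈-completions⁺ {h = zero}  (north s<x c)     = ∈-northFirst⁺ s<x c
∈-completions⁺ {h = suc _} (north s<x c)     = ∈-++⁺ˡ (∈-northFirst⁺ s<x c)
∈-completions⁺ {π = []}    (east c)          = ∈-map⁺ (E ∷_) (∈-completions⁺ c)
∈-completions⁺ {s} {suc h} {x ∷ π} (east c)  =
  ∈-++⁺ʳ (northFirst s (suc h) x π) (∈-map⁺ (E ∷_) (∈-completions⁺ c))

∈-northFirst⁺ {s} {x = x} s<x c with increasingNN? s (N x)
... | yes _   = ∈-map⁺ (N x ∷_) (∈-completions⁺ c)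
... | no  s≮x = contradiction s<x s≮x

∈-completions⁻ : ∀ s h π {p} → p ∈ completions s h π → Completion s h π p
∈-northFirst⁻  : ∀ s h x π {p} → p ∈ northFirst s h x π → Completion s h (x ∷ π) p

∈-completions⁻ s zero    []      (here refl) = done
∈-completions⁻ s (suc h) []      p∈ with ∈-map⁻ (E ∷_) p∈
... | _ , q∈ , refl = east (∈-completions⁻ E h [] q∈)
∈-completions⁻ s zero    (x ∷ π) p∈ = ∈-northFirst⁻ s zero x π p∈
∈-completions⁻ s (suc h) (x ∷ π) p∈ with ∈-++⁻ (northFirst s (suc h) x π) p∈
... | inj₁ p∈N = ∈-northFirst⁻ s (suc h) x π p∈N
... | inj₂ p∈E with ∈-map⁻ (E ∷_) p∈E
...   | _ , q∈ , refl = east (∈-completions⁻ E h (x ∷ π) q∈)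

∈-northFirst⁻ s h x π p∈ with increasingNN? s (N x)
... | no  _   = contradiction p∈ λ ()
... | yes s<x with ∈-map⁻ (N x ∷_) p∈
...   | _ , q∈ , refl = north s<x (∈-completions⁻ (N x) (suc h) π q∈)

completions-unique : ∀ s h π → Unique (completions s h π)
northFirst-unique  : ∀ s h x π → Unique (northFirst s h x π)

completions-unique s zero    []      = [] ∷ []
completions-unique s (suc h) []      = Unique.map⁺ ∷-injectiveʳ (completions-unique E h [])
completions-unique s zero    (x ∷ π) = northFirst-unique s zero x π
completions-unique s (suc h) (x ∷ π) =
  Unique.++⁺ (northFirst-unique s (suc h) x π)
             (Unique.map⁺ ∷-injectiveʳ (completions-unique E h (x ∷ π)))
             disjoint
  where
  disjoint : Disjoint (northFirst s (suc h) x π) (map (E ∷_) (completions E h (x ∷ π)))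
  disjoint (p∈N , p∈E) with increasingNN? s (N x)
  ... | no  _ = contradiction p∈N λ ()
  ... | yes _ with ∈-map⁻ (N x ∷_) p∈N | ∈-map⁻ (E ∷_) p∈E
  ...   | _ , _ , refl | _ , _ , ()

northFirst-unique s h x π with increasingNN? s (N x)
... | yes _ = Unique.map⁺ ∷-injectiveʳ (completions-unique (N x) (suc h) π)
... | no  _ = []

completion-φ : ∀ {s h π p} → Completion s h π p → φ p ≡ π
completion-φ done        = refl
completion-φ (north _ c) = cong (_ ∷_) (completion-φ c)
completion-φ (east c)    = completion-φ c

IncreasingNN-E : ∀ s → IncreasingNN s E
IncreasingNN-E (N _) = tt
IncreasingNN-E E     = tt

completion-linked : ∀ {s h π p} → Completion s h π p → Linked IncreasingNN (s ∷ p)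
completion-linked done            = [-]
completion-linked (north s<x c)   = s<x ∷ completion-linked c
completion-linked {s} (east c)    = IncreasingNN-E s ∷ completion-linked c

completion-balanced : ∀ {s h π p} → Completion s h π p → #E p ≡ h + #N p
completion-balanced done                          = refl
completion-balanced {h = h} {p = N _ ∷ p} (north _ c) =
  trans (completion-balanced c) (sym (+-suc h (#N p)))
completion-balanced (east c)                      = cong suc (completion-balanced c)

completion-prefixes : ∀ {s h π p} → Completion s h π p →
                      All (λ q → #E q ≤ h + #N q) (inits p)
completion-prefixes done        = z≤n ∷ []
completion-prefixes {h = h} (north _ c) =
  z≤n ∷ All.map⁺ (All.map (λ {q} → subst (#E q ≤_) (sym (+-suc h (#N q)))) (completion-prefixes c))
completion-prefixes (east c)    = z≤n ∷ All.map⁺ (All.map s≤s (completion-prefixes c))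

completion : ∀ {s h} p → #E p ≡ h + #N p → All (λ q → #E q ≤ h + #N q) (inits p) →
             Linked IncreasingNN (s ∷ p) → Completion s h (φ p) p
completion {h = zero}  []        _  _        _         = done
completion {h = suc _} []        () _        _
completion {h = h}     (N x ∷ p) eq (_ ∷ ps) (s<x ∷ l) =
  north s<x (completion p (trans eq (+-suc h (#N p)))
    (All.map (λ {q} → subst (#E q ≤_) (+-suc h (#N q))) (All.map⁻ ps)) l)
-- At height 0 the prefix consisting of this single E already lies below the diagonal.
completion {h = zero}  (E ∷ p)   _  (_ ∷ () ∷ _) _
completion {h = suc _} (E ∷ p)   eq (_ ∷ ps) (_ ∷ l)   =
  east (completion p (suc-injective eq) (All.map s≤s⁻¹ (All.map⁻ ps)) l)

#N≡length-φ : ∀ p → #N p ≡ length (φ p)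
#N≡length-φ []        = refl
#N≡length-φ (N _ ∷ p) = cong suc (#N≡length-φ p)
#N≡length-φ (E ∷ p)   = #N≡length-φ p

-- A fictitious E before the path leaves the first label unconstrained, so (E, 0) is the right
-- initial state.
isParkingFunction⇔ : ∀ {n} p →
  IsParkingFunction n p ⇔ (IsPermutation n (φ p) × Completion E 0 (φ p) p)
isParkingFunction⇔ {n} p = mk⇔ to from
  where
  prepend-E : ∀ {q} → Linked IncreasingNN q → Linked IncreasingNN (E ∷ q)
  prepend-E {[]}    _ = [-]
  prepend-E {_ ∷ _} l = tt ∷ l

  to : IsParkingFunction n p → IsPermutation n (φ p) × Completion E 0 (φ p) p
  to (isParkingFunction (#N≡n , #E≡n , prefixes) perm runs) =
    perm , completion p (trans #E≡n (sym #N≡n)) prefixes (prepend-E runs)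

  from : IsPermutation n (φ p) × Completion E 0 (φ p) p → IsParkingFunction n p
  from (perm , c) = isParkingFunction
    (#N≡n , trans (completion-balanced c) #N≡n , completion-prefixes c)
    perm (Linked.tail (completion-linked c))
    where
    #N≡n : #N p ≡ n
    #N≡n = trans (#N≡length-φ p) (trans (↭-length perm) (length-applyUpTo suc n))

-- Summing path counts over a class of permutations

paths : List ℕ → List (List Step)
paths = completions E 0

length-concatMap : ∀ {A B : Set} (f : A → List B) xs →
                   length (concatMap f xs) ≡ sum (map (length ∘ f) xs)
length-concatMap f []       = refl
length-concatMap f (x ∷ xs) =
  trans (length-++ (f x)) (cong (length (f x) +_) (length-concatMap f xs))

sum⟦1⋯_⟧ : ∀ n → sum ⟦1⋯ n ⟧ ≡ (n + 1) C 2
sum⟦1⋯ zero  ⟧ = refl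
sum⟦1⋯ suc n ⟧ = begin
  sum ⟦1⋯ suc n ⟧              ≡⟨ cong sum (applyUpTo-∷ʳ suc n) ⟨
  sum (⟦1⋯ n ⟧ ++ [ suc n ])   ≡⟨ sum-++ ⟦1⋯ n ⟧ [ suc n ] ⟩
  sum ⟦1⋯ n ⟧ + (suc n + 0)    ≡⟨ cong₂ _+_ sum⟦1⋯ n ⟧ (+-identityʳ (suc n)) ⟩
  (n + 1) C 2 + suc n          ≡⟨ +-comm ((n + 1) C 2) (suc n) ⟩
  suc n + (n + 1) C 2          ≡⟨ cong (_+ (n + 1) C 2) (trans (sym (+-comm n 1)) (sym (nC1≡n (n + 1)))) ⟩
  (n + 1) C 1 + (n + 1) C 2    ≡⟨ nCk+nC[k+1]≡[n+1]C[k+1] (n + 1) 1 ⟩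
  (suc n + 1) C 2              ∎
  where open ≡-Reasoning

-- The fibre of `φ` over an avoider π is `paths π`. Fibres are disjoint because a path determines
-- its reading word, so two duplicate-free lists with the same members are compared; the fibre sizes
-- then add up to 1 + ⋯ + n.
pf-count : ∀ n ρs πs →
  (∀ {π} → (π ∈ πs) ⇔ (IsPermutation n π × All (π Avoids_) ρs)) →
  map (length ∘ paths) πs ↭ ⟦1⋯ n ⟧ →
  pf n ρs ≡ (n + 1) C 2
pf-count n ρs πs πs⇔ counts = begin
  pf n ρs                           ≡⟨ ↭-length (∼bag⇒↭ (unique∧set⇒bag lhs! rhs! (mk⇔ to from))) ⟩
  length (concatMap paths πs)       ≡⟨ length-concatMap paths πs ⟩
  sum (map (length ∘ paths) πs)     ≡⟨ sum-↭ counts ⟩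
  sum ⟦1⋯ n ⟧                       ≡⟨ sum⟦1⋯ n ⟧ ⟩
  (n + 1) C 2                       ∎
  where
  open ≡-Reasoning

  avoiding : List (List Step)
  avoiding = filter (λ p → All.all? (avoids? (φ p)) ρs) (parkingFunctions n)

  lhs! : Unique avoiding
  lhs! = Unique.filter⁺ _ (parkingFunctions-unique n)

  -- The path counts of the listed permutations are distinct, hence so are the permutations.
  πs! : Unique πs
  πs! = Unique.map⁻ {f = length ∘ paths} (Permutation.Unique-resp-↭ (setoid ℕ) (↭⇒↭ₛ (↭-sym counts))
          (Unique.applyUpTo⁺₁ suc n (λ i<j _ → <⇒≢ (s<s i<j))))

  paths-disjoint : ∀ {π π′} → π ≢ π′ → Disjoint (paths π) (paths π′)
  paths-disjoint π≢π′ (p∈ , p∈′) =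
    π≢π′ (trans (sym (completion-φ (∈-completions⁻ E 0 _ p∈)))
                (completion-φ (∈-completions⁻ E 0 _ p∈′)))

  rhs! : Unique (concatMap paths πs)
  rhs! = Unique.concat⁺ (All.map⁺ (All.universal (completions-unique E 0) πs))
                        (AllPairs.map⁺ (AllPairs.map paths-disjoint πs!))

  to : ∀ {p} → p ∈ avoiding → p ∈ concatMap paths πs
  to {p} p∈ with ∈-filter⁻ (λ p → All.all? (avoids? (φ p)) ρs) {xs = parkingFunctions n} p∈
  ... | p∈pf , av with Equivalence.to (isParkingFunction⇔ p) (Equivalence.to (∈-parkingFunctions⇔ n p) p∈pf)
  ...   | perm , c =
    ∈-concatMap⁺ paths (Any.map (λ { refl → ∈-completions⁺ c }) (Equivalence.from πs⇔ (perm , av)))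

  from : ∀ {p} → p ∈ concatMap paths πs → p ∈ avoiding
  from {p} p∈ with find (∈-concatMap⁻ paths {xs = πs} p∈)
  ... | π , π∈ , p∈π with ∈-completions⁻ E 0 π p∈π
  ...   | c with completion-φ c
  ...     | refl with Equivalence.to πs⇔ π∈
  ...       | perm , av =
    ∈-filter⁺ (λ p → All.all? (avoids? (φ p)) ρs)
      (Equivalence.from (∈-parkingFunctions⇔ n p) (Equivalence.from (isParkingFunction⇔ p) (perm , c)))
      av

-- Path counts for words with at most one ascent

#completions : Step → ℕ → List ℕ → ℕ
#completions s h π = length (completions s h π)

#completions-E-zero : ∀ x π → #completions E 0 (x ∷ π) ≡ #completions (N x) 1 π
#completions-E-zero x π = length-map (N x ∷_) (completions (N x) 1 π)

#northFirst : ∀ {s x} h π → IncreasingNN s (N x) →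
              length (northFirst s h x π) ≡ #completions (N x) (suc h) π
#northFirst {s} {x} h π s<x with increasingNN? s (N x)
... | yes _   = length-map (N x ∷_) (completions (N x) (suc h) π)
... | no  s≮x = contradiction s<x s≮x

northFirst-empty : ∀ {s x} h π → ¬ IncreasingNN s (N x) → northFirst s h x π ≡ []
northFirst-empty {s} {x} h π s≮x with increasingNN? s (N x)
... | yes s<x = contradiction s<x s≮x
... | no  _   = refl

#completions-suc : ∀ s h x π → #completions s (suc h) (x ∷ π) ≡
                   length (northFirst s (suc h) x π) + #completions E h (x ∷ π)
#completions-suc s h x π = trans (length-++ (northFirst s (suc h) x π))
  (cong (length (northFirst s (suc h) x π) +_) (length-map (E ∷_) (completions E h (x ∷ π))))

#completions-ascent : ∀ {s x} h π → IncreasingNN s (N x) → #completions s (suc h) (x ∷ π) ≡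
                      #completions (N x) (2 + h) π + #completions E h (x ∷ π)
#completions-ascent {s} {x} h π s<x = trans (#completions-suc s h x π)
  (cong (_+ #completions E h (x ∷ π)) (#northFirst (suc h) π s<x))

#completions-descent : ∀ {x y} h π → x > y →
                       #completions (N x) (suc h) (y ∷ π) ≡ #completions E h (y ∷ π)
#completions-descent {x} {y} h π x>y = trans (#completions-suc (N x) h y π)
  (cong (λ ps → length ps + #completions E h (y ∷ π)) (northFirst-empty (suc h) π (<-asym x>y)))

Decreasing : List ℕ → Set
Decreasing = AllPairs _>_

-- At height 1 a descent forces E, and on the diagonal only N is possible: the rest can only be E N
-- E N ... E.
decreasing-#1 : ∀ {x π} → Decreasing (x ∷ π) → #completions (N x) 1 π ≡ 1
decreasing-#1 {π = []}    _                      = refl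
decreasing-#1 {π = y ∷ π} ((x>y ∷ _) ∷ dec) =
  trans (#completions-descent 0 π x>y) (trans (#completions-E-zero y π) (decreasing-#1 dec))

-- One E is spare. The descent forces an E down to height 1; a second E there leaves no further
-- choice, while N returns to height 2 with one entry fewer. Each entry thus adds one completion.
decreasing-#2 : ∀ {x π} → Decreasing (x ∷ π) → #completions (N x) 2 π ≡ suc (length π)
decreasing-#2 {π = []}    _                 = refl
decreasing-#2 {π = y ∷ π} ((x>y ∷ _) ∷ dec) = begin
  _                                             ≡⟨ #completions-descent 1 π x>y ⟩
  _                                             ≡⟨ #completions-ascent {E} 0 π tt ⟩
  #completions (N y) 2 π + #completions E 0 (y ∷ π)
    ≡⟨ cong₂ _+_ (decreasing-#2 dec) (trans (#completions-E-zero y π) (decreasing-#1 dec)) ⟩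
  suc (length π) + 1                            ≡⟨ +-comm (suc (length π)) 1 ⟩
  suc (suc (length π))                          ∎
  where open ≡-Reasoning

-- The descents of `x ∷ α` force N E N E ..., so its last entry ends at height 1. From there N leads
-- to the situation of `decreasing-#2`, and E followed by N to that of `decreasing-#1`. Writing the
-- head of β as `take 1 β` admits an empty β, where there is no ascent.
#paths-one-ascent : ∀ {x} α {β} → Decreasing (x ∷ α) → Decreasing β →
                    All (λ a → All (a <_) (take 1 β)) (x ∷ α) →
                    length (paths (x ∷ α ++ β)) ≡ suc (length β)
#paths-one-ascent {x} []      {[]}    _ _ _ = refl
#paths-one-ascent {x} []      {y ∷ β} _ dec ((x<y ∷ _) ∷ _) = begin
  #completions E 0 (x ∷ y ∷ β)                  ≡⟨ #completions-E-zero x (y ∷ β) ⟩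
  #completions (N x) 1 (y ∷ β)                  ≡⟨ #completions-ascent {N x} 0 β x<y ⟩
  #completions (N y) 2 β + #completions E 0 (y ∷ β)
    ≡⟨ cong₂ _+_ (decreasing-#2 dec) (trans (#completions-E-zero y β) (decreasing-#1 dec)) ⟩
  suc (length β) + 1                            ≡⟨ +-comm (suc (length β)) 1 ⟩
  suc (suc (length β))                          ∎
  where open ≡-Reasoning
#paths-one-ascent {x} (a ∷ α) {β} ((x>a ∷ _) ∷ dec) decβ (_ ∷ α<β) =
  trans (#completions-E-zero x (a ∷ α ++ β))
    (trans (#completions-descent 0 (α ++ β) x>a) (#paths-one-ascent α dec decβ α<β))

-- From the diagonal a descent forces N E, back to the diagonal, so the first entry can be cut off.
#paths-descent : ∀ {x y} π → x > y → length (paths (x ∷ y ∷ π)) ≡ length (paths (y ∷ π))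
#paths-descent {x} {y} π x>y =
  trans (#completions-E-zero x (y ∷ π)) (#completions-descent 0 π x>y)

-- Patterns of length three as conditions on triples

-- An inductive form of avoidance: the first entry x leaves the binary condition `P x` on the tail,
-- which can then be treated as a kind of sortedness.
data AllTriples (P : ℕ → ℕ → ℕ → Set) : List ℕ → Set where
  []  : AllTriples P []
  _∷_ : ∀ {x xs} → AllPairs (P x) xs → AllTriples P xs → AllTriples P (x ∷ xs)

AllPairs-lookup : ∀ {R : ℕ → ℕ → Set} {xs} → AllPairs R xs →
                  ∀ {i j} → i Fin.< j → R (lookup xs i) (lookup xs j)
AllPairs-lookup (r ∷ _)  {Fin.zero}  {Fin.suc j} _         = All.lookup r (∈-lookup j)
AllPairs-lookup (_ ∷ rs) {Fin.suc _} {Fin.suc _} (s<s i<j) = AllPairs-lookup rs i<j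

AllPairs-tabulate : ∀ {R : ℕ → ℕ → Set} xs →
                    (∀ {i j} → i Fin.< j → R (lookup xs i) (lookup xs j)) → AllPairs R xs
AllPairs-tabulate {R} xs f = subst (AllPairs R) (tabulate-lookup xs) (AllPairs.tabulate⁺-< f)

module _ {P : ℕ → ℕ → ℕ → Set} where

  AllTriples-lookup : ∀ {xs} → AllTriples P xs → ∀ {i j k} → i Fin.< j → j Fin.< k →
                      P (lookup xs i) (lookup xs j) (lookup xs k)
  AllTriples-lookup (p ∷ _)  {Fin.zero}  {Fin.suc _} {Fin.suc _} _         (s<s j<k) =
    AllPairs-lookup p j<k
  AllTriples-lookup (_ ∷ ps) {Fin.suc _} {Fin.suc _} {Fin.suc _} (s<s i<j) (s<s j<k) =
    AllTriples-lookup ps i<j j<k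

  AllTriples-tabulate : ∀ xs → (∀ {i j k} → i Fin.< j → j Fin.< k →
                        P (lookup xs i) (lookup xs j) (lookup xs k)) → AllTriples P xs
  AllTriples-tabulate []       _ = []
  AllTriples-tabulate (x ∷ xs) f =
    AllPairs-tabulate xs (λ {j} {k} j<k → f {Fin.zero} {Fin.suc j} {Fin.suc k} z<s (s<s j<k)) ∷
    AllTriples-tabulate xs (λ i<j j<k → f (s<s i<j) (s<s j<k))

-- The pattern a b c has its smallest, middle and largest entry at the positions u, v and w.
record Pattern (a b c : ℕ) (u v w : Fin 3) : Set where
  field
    low   : lookup (a ∷ b ∷ c ∷ []) u < lookup (a ∷ b ∷ c ∷ []) v
    high  : lookup (a ∷ b ∷ c ∷ []) v < lookup (a ∷ b ∷ c ∷ []) w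
    cover : ∀ t → t ≡ u ⊎ t ≡ v ⊎ t ≡ w

Avoid : (u v w : Fin 3) → ℕ → ℕ → ℕ → Set
Avoid u v w x y z = ¬ (Vec.lookup xyz u < Vec.lookup xyz v × Vec.lookup xyz v < Vec.lookup xyz w)
  where
  xyz : Vec ℕ 3
  xyz = x ∷ y ∷ z ∷ []

module _ {a b c u v w} (pat : Pattern a b c u v w) where
  open Pattern pat

  avoids⁻ : ∀ {π} → π Avoids (a ∷ b ∷ c ∷ []) → AllTriples (Avoid u v w) π
  avoids⁻ {π} avoids = AllTriples-tabulate π λ {i} {j} {k} i<j j<k occ →
    avoids (i ∷ j ∷ k ∷ [] , i<j VecLinked.∷ j<k VecLinked.∷ VecLinked.[-] ,
            sameOrder (i ∷ j ∷ k ∷ []) (subst₂ _<_ (at i j k u) (at i j k v) (proj₁ occ))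
                                       (subst₂ _<_ (at i j k v) (at i j k w) (proj₂ occ)))
    where
    at : ∀ i j k t → Vec.lookup (lookup π i ∷ lookup π j ∷ lookup π k ∷ []) t ≡
                     lookup π (Vec.lookup (i ∷ j ∷ k ∷ []) t)
    at i j k = λ { 0F → refl ; 1F → refl ; 2F → refl }

    both : ∀ {x y x′ y′} → x ≤ y → x′ ≤ y′ → (x ≤ y) ⇔ (x′ ≤ y′)
    both p q = mk⇔ (λ _ → q) (λ _ → p)

    neither : ∀ {x y x′ y′} → y < x → y′ < x′ → (x ≤ y) ⇔ (x′ ≤ y′)
    neither p q = mk⇔ (λ r → contradiction r (<⇒≱ p)) (λ r → contradiction r (<⇒≱ q))

    sameOrder : ∀ i → lookup π (Vec.lookup i u) < lookup π (Vec.lookup i v) →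
                lookup π (Vec.lookup i v) < lookup π (Vec.lookup i w) →
                SameOrder π (a ∷ b ∷ c ∷ []) i
    sameOrder i lo hi s t with cover s | cover t
    ... | inj₁ refl        | inj₁ refl        = both ≤-refl ≤-refl
    ... | inj₁ refl        | inj₂ (inj₁ refl) = both (<⇒≤ lo) (<⇒≤ low)
    ... | inj₁ refl        | inj₂ (inj₂ refl) = both (<⇒≤ (<-trans lo hi)) (<⇒≤ (<-trans low high))
    ... | inj₂ (inj₁ refl) | inj₁ refl        = neither lo low
    ... | inj₂ (inj₁ refl) | inj₂ (inj₁ refl) = both ≤-refl ≤-refl
    ... | inj₂ (inj₁ refl) | inj₂ (inj₂ refl) = both (<⇒≤ hi) (<⇒≤ high)
    ... | inj₂ (inj₂ refl) | inj₁ refl        = neither (<-trans lo hi) (<-trans low high)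
    ... | inj₂ (inj₂ refl) | inj₂ (inj₁ refl) = neither hi high
    ... | inj₂ (inj₂ refl) | inj₂ (inj₂ refl) = both ≤-refl ≤-refl

  avoids⁺ : ∀ {π} → AllTriples (Avoid u v w) π → π Avoids (a ∷ b ∷ c ∷ [])
  avoids⁺ {π} ts (i₀ ∷ i₁ ∷ i₂ ∷ [] , i₀<i₁ VecLinked.∷ i₁<i₂ VecLinked.∷ VecLinked.[-] , same) =
    AllTriples-lookup ts i₀<i₁ i₁<i₂ (less u v low , less v w high)
    where
    at : ∀ t → lookup π (Vec.lookup (i₀ ∷ i₁ ∷ i₂ ∷ []) t) ≡
               Vec.lookup (lookup π i₀ ∷ lookup π i₁ ∷ lookup π i₂ ∷ []) t
    at = λ { 0F → refl ; 1F → refl ; 2F → refl }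

    less : ∀ s t → lookup (a ∷ b ∷ c ∷ []) s < lookup (a ∷ b ∷ c ∷ []) t →
           Vec.lookup (lookup π i₀ ∷ lookup π i₁ ∷ lookup π i₂ ∷ []) s <
           Vec.lookup (lookup π i₀ ∷ lookup π i₁ ∷ lookup π i₂ ∷ []) t
    -- `SameOrder` speaks of ≤ only; the strict inequality comes from refuting the reversed one.
    less s t s<t = subst₂ _<_ (at s) (at t)
      (≰⇒> λ πt≤πs → <⇒≱ s<t (Equivalence.to (same t s) πt≤πs))

-- Decreasing words and words ordered by a relation

applyDownFrom↭applyUpTo : ∀ (f : ℕ → ℕ) n → applyDownFrom f n ↭ applyUpTo f n
applyDownFrom↭applyUpTo f n =
  ↭-trans (↭-sym (↭-reverse (applyDownFrom f n))) (↭-reflexive (reverse-applyDownFrom f n))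

AllTriples-map : ∀ {P Q : ℕ → ℕ → ℕ → Set} → (∀ {x y z} → P x y z → Q x y z) →
                 ∀ {xs} → AllTriples P xs → AllTriples Q xs
AllTriples-map f []       = []
AllTriples-map f (p ∷ ps) = AllPairs.map f p ∷ AllTriples-map f ps

AllTriples-zip : ∀ {P Q : ℕ → ℕ → ℕ → Set} {xs} → AllTriples P xs → AllTriples Q xs →
                 AllTriples (λ x y z → P x y z × Q x y z) xs
AllTriples-zip []       []       = []
AllTriples-zip (p ∷ ps) (q ∷ qs) = AllPairs.zip (p , q) ∷ AllTriples-zip ps qs

All⇒AllPairs : ∀ {P : ℕ → Set} {xs} → All P xs → AllPairs (λ x y → P x × P y) xs
All⇒AllPairs []       = []
All⇒AllPairs (p ∷ ps) = All.map (p ,_) ps ∷ All⇒AllPairs ps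

decreasing⇒AllTriples : ∀ {P : ℕ → ℕ → ℕ → Set} → (∀ {x y z} → x > y → y > z → P x y z) →
                        ∀ {xs} → Decreasing xs → AllTriples P xs
decreasing⇒AllTriples f []            = []
decreasing⇒AllTriples f (x>xs ∷ dec)  =
  AllPairs.zipWith (λ { ((x>y , _) , y>z) → f x>y y>z }) (All⇒AllPairs x>xs , dec) ∷
  decreasing⇒AllTriples f dec

AllPairs-∈ : ∀ {R : ℕ → ℕ → Set} {xs x y} → AllPairs R xs → x ∈ xs → y ∈ xs →
             x ≡ y ⊎ R x y ⊎ R y x
AllPairs-∈ _        (here refl) (here refl) = inj₁ refl
AllPairs-∈ (r ∷ _)  (here refl) (there y∈)  = inj₂ (inj₁ (All.lookup r y∈))
AllPairs-∈ (r ∷ _)  (there x∈)  (here refl) = inj₂ (inj₂ (All.lookup r x∈))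
AllPairs-∈ (_ ∷ rs) (there x∈)  (there y∈)  = AllPairs-∈ rs x∈ y∈

-- If the heads differed, each would occur in the other tail, and R would hold between them both
-- ways. R will be `P m` for a fixed first entry m, whose antisymmetry is known only on the entries
-- at hand.
ordered-unique : ∀ {R : ℕ → ℕ → Set} {xs ys} →
                 (∀ {x y} → x ∈ ys → y ∈ ys → R x y → R y x → x ≡ y) →
                 AllPairs R xs → AllPairs R ys → xs ↭ ys → xs ≡ ys
ordered-unique {xs = []}     {[]}     _    _        _        _ = refl
ordered-unique {xs = []}     {_ ∷ _}  _    _        _        p = contradiction (↭-length p) λ ()
ordered-unique {xs = _ ∷ _}  {[]}     _    _        _        p = contradiction (↭-length p) λ ()
ordered-unique {xs = x ∷ xs} {y ∷ ys} anti (r ∷ rs) (q ∷ qs) p with x≡y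
  where
  x≡y : x ≡ y
  x≡y with ∈-resp-↭ p (here refl) | ∈-resp-↭ (↭-sym p) (here refl)
  ... | here eq    | _          = eq
  ... | there _    | here eq    = sym eq
  ... | there x∈ys | there y∈xs = anti (there x∈ys) (here refl) (All.lookup r y∈xs) (All.lookup q x∈ys)
... | refl = cong (x ∷_)
  (ordered-unique (λ x∈ y∈ → anti (there x∈) (there y∈)) rs qs (drop-∷ p))

-- Inserting an extreme entry into a decreasing word

insertions : ℕ → List ℕ → List (List ℕ)
insertions m []      = [ [ m ] ]
insertions m (d ∷ D) = (m ∷ d ∷ D) ∷ map (d ∷_) (insertions m D)

insertion-↭ : ∀ {m π} D → π ∈ insertions m D → π ↭ m ∷ D
insertion-↭ []      (here refl) = ↭-refl
insertion-↭ (d ∷ D) (here refl) = ↭-refl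
insertion-↭ (d ∷ D) (there π∈) with ∈-map⁻ (d ∷_) π∈
... | _ , ρ∈ , refl = ↭-trans (↭-prep d (insertion-↭ D ρ∈)) (↭-swap d _ ↭-refl)

insertion-AllPairs : ∀ {R : ℕ → ℕ → Set} {m π} D → π ∈ insertions m D → AllPairs R D →
                     All (λ z → R m z × R z m) D → AllPairs R π
insertion-AllPairs []      (here refl) _        _        = [] ∷ []
insertion-AllPairs (d ∷ D) (here refl) rs       ms       = All.map proj₁ ms ∷ rs
insertion-AllPairs (d ∷ D) (there π∈)  (r ∷ rs) (m ∷ ms) with ∈-map⁻ (d ∷_) π∈
... | _ , ρ∈ , refl =
  All-resp-↭ (↭-sym (insertion-↭ D ρ∈)) (proj₂ m ∷ r) ∷ insertion-AllPairs D ρ∈ rs ms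

-- A triple of the new word either lies in D or joins m to a pair of D, with m in first, second or
-- third place.
insertion-AllTriples : ∀ {P : ℕ → ℕ → ℕ → Set} {m π} D → π ∈ insertions m D → AllTriples P D →
                       AllPairs (λ y z → P m y z × P y m z × P y z m) D → AllTriples P π
insertion-AllTriples []      (here refl) _        _        = [] ∷ []
insertion-AllTriples (d ∷ D) (here refl) ts       ms       = AllPairs.map proj₁ ms ∷ ts
insertion-AllTriples (d ∷ D) (there π∈)  (t ∷ ts) (m ∷ ms) with ∈-map⁻ (d ∷_) π∈
... | _ , ρ∈ , refl =
  insertion-AllPairs D ρ∈ t (All.map proj₂ m) ∷ insertion-AllTriples D ρ∈ ts ms

-- S is the side of m on which the other entries lie: all below m or all above m.
module _ {P : ℕ → ℕ → ℕ → Set} {m : ℕ} (S : ℕ → Set) (¬Sm : ¬ S m)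
         (decreasing : ∀ {x y z} → x > y → y > z → P x y z)
         (descent : ∀ {y z} → S y → S z → y > z → P m y z × P y m z × P y z m)
         (ascent  : ∀ {y z} → S y → S z → y < z → ¬ P m y z × ¬ P y m z × ¬ P y z m)
  where

  insertion-pairs : ∀ {D} → Decreasing D → All S D →
                    AllPairs (λ y z → P m y z × P y m z × P y z m) D
  insertion-pairs dec SD =
    AllPairs.zipWith (λ { (y>z , Sy , Sz) → descent Sy Sz y>z }) (dec , All⇒AllPairs SD)

  -- The first entry of π decides. If it is m, the rest is sorted by `P m`, and so is the decreasing
  -- word; if it is the largest entry d, recursion applies. Any other first entry h lies below d,
  -- and both m and d come after it: h and d ascend, with m between or behind them, contrary to
  -- `ascent`.
  ∈-insertions⁺ : ∀ {D π} → Decreasing D → All S D → π ↭ m ∷ D → AllTriples P π →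
                  π ∈ insertions m D
  ∈-insertions⁺ {[]}            _   _  p _ = here (↭-singleton-inv p)
  ∈-insertions⁺ {_ ∷ _} {[]}    _   _  p _ = contradiction (↭-length p) λ ()
  ∈-insertions⁺ {d ∷ D} {h ∷ π} dec@(d>D ∷ dec′) SdD@(Sd ∷ SD) p (t ∷ ts)
    with ∈-resp-↭ p (here refl)
  ... | here refl = here (cong (m ∷_)
          (ordered-unique anti t (AllPairs.map proj₁ (insertion-pairs dec SdD)) (drop-∷ p)))
    where
    anti : ∀ {x y} → x ∈ d ∷ D → y ∈ d ∷ D → P m x y → P m y x → x ≡ y
    anti {x} {y} x∈ y∈ pxy pyx with <-cmp x y
    ... | tri< x<y _ _ = contradiction pxy (proj₁ (ascent (All.lookup SdD x∈) (All.lookup SdD y∈) x<y))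
    ... | tri≈ _ x≡y _ = x≡y
    ... | tri> _ _ y<x = contradiction pyx (proj₁ (ascent (All.lookup SdD y∈) (All.lookup SdD x∈) y<x))
  ... | there (here refl) =
          there (∈-map⁺ (d ∷_) (∈-insertions⁺ dec′ SD (drop-∷ (↭-trans p (↭-swap m d ↭-refl))) ts))
  ... | there (there h∈D) with AllPairs-∈ t (m∈π (∈-resp-↭ (↭-sym p) (here refl)))
                                            (d∈π (∈-resp-↭ (↭-sym p) (there (here refl))))
    where
    d>h : d > h
    d>h = All.lookup d>D h∈D

    m∈π : m ∈ h ∷ π → m ∈ π
    m∈π (here refl) = contradiction (All.lookup SD h∈D) ¬Sm
    m∈π (there m∈)  = m∈

    d∈π : d ∈ h ∷ π → d ∈ π
    d∈π (here refl) = contradiction d>h (<-irrefl refl)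
    d∈π (there d∈)  = d∈
  ...   | inj₁ refl       = contradiction Sd ¬Sm
  ...   | inj₂ (inj₁ hmd) =
            contradiction hmd (proj₁ (proj₂ (ascent (All.lookup SD h∈D) Sd (All.lookup d>D h∈D))))
  ...   | inj₂ (inj₂ hdm) =
            contradiction hdm (proj₂ (proj₂ (ascent (All.lookup SD h∈D) Sd (All.lookup d>D h∈D))))

  ∈-insertions⇔ : ∀ {D} → Decreasing D → All S D →
                  ∀ {π} → (π ∈ insertions m D) ⇔ (π ↭ m ∷ D × AllTriples P π)
  ∈-insertions⇔ {D} dec SD = mk⇔
    (λ π∈ → insertion-↭ D π∈ ,
            insertion-AllTriples D π∈ (decreasing⇒AllTriples decreasing dec) (insertion-pairs dec SD))
    (λ (p , ts) → ∈-insertions⁺ dec SD p ts)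

-- With d in front, m always creates an ascent, and β is m with all that follows it. Moving m one
-- place to the right shortens β by one; `#paths-descent` strips the entries before the ascent.
#paths-insertions-max′ : ∀ {m d} D → Decreasing (d ∷ D) → All (_< m) (d ∷ D) →
  map (length ∘ paths) (map (d ∷_) (insertions m D)) ≡ applyDownFrom (2 +_) (suc (length D))
#paths-insertions-max′ []       _ (d<m ∷ []) =
  cong [_] (#paths-one-ascent [] ([] ∷ []) ([] ∷ []) ((d<m ∷ []) ∷ []))
#paths-insertions-max′ {m} {d} (e ∷ D) ((d>e ∷ _) ∷ dec) (d<m ∷ <m) = cong₂ _∷_
  (#paths-one-ascent [] ([] ∷ []) (<m ∷ dec) ((d<m ∷ []) ∷ []))
  (begin
    map (length ∘ paths) (map (d ∷_) (map (e ∷_) (insertions m D))) ≡⟨ map-∘ (map (e ∷_) (insertions m D)) ⟨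
    map (length ∘ paths ∘ (d ∷_)) (map (e ∷_) (insertions m D))     ≡⟨ map-∘ (insertions m D) ⟨
    map (length ∘ paths ∘ (d ∷_) ∘ (e ∷_)) (insertions m D)
      ≡⟨ map-cong (λ π → #paths-descent π d>e) (insertions m D) ⟩
    map (length ∘ paths ∘ (e ∷_)) (insertions m D)                  ≡⟨ map-∘ (insertions m D) ⟩
    map (length ∘ paths) (map (e ∷_) (insertions m D))              ≡⟨ #paths-insertions-max′ D dec <m ⟩
    applyDownFrom (2 +_) (suc (length D))                           ∎)
  where open ≡-Reasoning

#paths-decreasing : ∀ x {π} → Decreasing (x ∷ π) → length (paths (x ∷ π)) ≡ 1
#paths-decreasing x {π} dec = trans (#completions-E-zero x π) (decreasing-#1 dec)

-- In first place m creates no ascent. For nonempty D the counts therefore read 1, n, ..., 2 with n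
-- = length D + 1, which is ⟦1⋯ n ⟧ only up to order.
#paths-insertions-max : ∀ {m} D → Decreasing D → All (_< m) D →
  map (length ∘ paths) (insertions m D) ↭ ⟦1⋯ suc (length D) ⟧
#paths-insertions-max     []      _   _  = ↭-refl
#paths-insertions-max {m} (d ∷ D) dec <m = begin
  length (paths (m ∷ d ∷ D)) ∷ map (length ∘ paths) (map (d ∷_) (insertions m D))
    ≡⟨ cong₂ _∷_ (#paths-decreasing m (<m ∷ dec)) (#paths-insertions-max′ D dec <m) ⟩
  1 ∷ applyDownFrom (2 +_) (suc (length D)) ↭⟨ ↭-prep 1 (applyDownFrom↭applyUpTo (2 +_) (suc (length D))) ⟩
  1 ∷ applyUpTo (2 +_) (suc (length D))     ∎
  where open PermutationReasoning

-- The ascent now follows m, and β is the part of D behind m, shrinking from all of D to the empty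
-- word.
#paths-insertions-min : ∀ {m} D → Decreasing D → All (m <_) D →
  map (length ∘ paths) (insertions m D) ≡ applyDownFrom suc (suc (length D))
#paths-insertions-min     []      _                 _          = refl
#paths-insertions-min {m} (d ∷ D) (d>D ∷ dec) (m<d ∷ m<D) = cong₂ _∷_
  (#paths-one-ascent [] ([] ∷ []) (d>D ∷ dec) ((m<d ∷ []) ∷ []))
  (begin
    map (length ∘ paths) (map (d ∷_) (insertions m D)) ≡⟨ map-∘ (insertions m D) ⟨
    map (length ∘ paths ∘ (d ∷_)) (insertions m D)
      ≡⟨ map-cong-local (All.tabulate λ π∈ → drop-head (insertion-↭ D π∈)) ⟩
    map (length ∘ paths) (insertions m D)              ≡⟨ #paths-insertions-min D dec m<D ⟩
    applyDownFrom suc (suc (length D))                 ∎)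
  where
  open ≡-Reasoning

  -- The entry after d is m or belongs to D, hence is smaller than d.
  drop-head : ∀ {π} → π ↭ m ∷ D → length (paths (d ∷ π)) ≡ length (paths π)
  drop-head {[]}    p = contradiction (↭-length p) λ ()
  drop-head {x ∷ π} p = #paths-descent π (All.head (All-resp-↭ (↭-sym p) (m<d ∷ d>D)))

-- Rotations of a decreasing word

AllTriples-∷ʳ : ∀ {P : ℕ → ℕ → ℕ → Set} {xs x} → AllTriples P xs →
                AllPairs (λ y z → P y z x) xs → AllTriples P (xs ++ [ x ])
AllTriples-∷ʳ []       []       = [] ∷ []
AllTriples-∷ʳ (t ∷ ts) (p ∷ ps) =
  AllPairs.++⁺ t ([] ∷ []) (All.map (_∷ []) p) ∷ AllTriples-∷ʳ ts ps

rotation : ℕ → List ℕ → List ℕ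
rotation k D = drop k D ++ take k D

rotation-↭ : ∀ k D → rotation k D ↭ D
rotation-↭ k D = ↭-trans (++-comm (drop k D) (take k D)) (↭-reflexive (take++drop≡id k D))

rotation-length : ∀ ys {zs : List ℕ} → rotation (length ys) (ys ++ zs) ≡ zs ++ ys
rotation-length ys {zs} = cong₂ _++_ (drop-length ys) (take-length ys)
  where
  drop-length : ∀ ys → drop (length ys) (ys ++ zs) ≡ zs
  drop-length []       = refl
  drop-length (_ ∷ ys) = drop-length ys

  take-length : ∀ ys → take (length ys) (ys ++ zs) ≡ ys
  take-length []       = refl
  take-length (y ∷ ys) = cong (y ∷_) (take-length ys)

rotations : List ℕ → List (List ℕ)
rotations D = map (λ k → rotation k D) (upTo (length D))

take>drop : ∀ k {D} → Decreasing D → All (λ x → All (x <_) (take k D)) (drop k D)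
take>drop zero    {D} _           = All.universal (λ _ → []) D
take>drop (suc k)     []          = []
take>drop (suc k)     (d>D ∷ dec) =
  All.zipWith (λ (x<d , x<D) → x<d ∷ x<D) (All.drop⁺ k d>D , take>drop k dec)

-- Here α is `drop k D`, nonempty because k < length D, and β is `take k D`; the only possible
-- ascent is at their junction.
#paths-rotation : ∀ {k D} → Decreasing D → k < length D → length (paths (rotation k D)) ≡ suc k
#paths-rotation {k} {D} dec k<n
  with drop k D | length-drop k D | AllPairs.drop⁺ k dec | take>drop k dec
... | []    | 0≡n∸k | _    | _   = contradiction (sym 0≡n∸k) (m>n⇒m∸n≢0 k<n)
... | _ ∷ α | _     | decα | α<β =
  trans (#paths-one-ascent α decα (AllPairs.take⁺ k dec) (All.map (All.take⁺ 1) α<β))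
        (cong suc (trans (length-take k D) (m≤n⇒m⊓n≡m (<⇒≤ k<n))))

#paths-rotations : ∀ {D} → Decreasing D →
                   map (length ∘ paths) (rotations D) ≡ ⟦1⋯ length D ⟧
#paths-rotations {D} dec = begin
  map (length ∘ paths) (rotations D)                        ≡⟨ map-∘ (upTo (length D)) ⟨
  map (λ k → length (paths (rotation k D))) (upTo (length D))
    ≡⟨ map-cong-local (All.map (#paths-rotation dec) (All.all-upTo (length D))) ⟩
  map suc (upTo (length D))                                 ≡⟨ map-upTo suc (length D) ⟩
  ⟦1⋯ length D ⟧                                            ∎
  where open ≡-Reasoning

module _ {P : ℕ → ℕ → ℕ → Set}
         (cyclic     : ∀ {x y z} → P x y z → P y z x)
         (decreasing : ∀ {x y z} → x > y → y > z → P x y z)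
         (ascent     : ∀ {x y z} → x ≢ y → x ≢ z → y < z → P x y z → ¬ P x z y)
  where

  -- Moving the first entry y to the end turns a triple y, a, b into a, b, y, which is what `cyclic`
  -- permits.
  rotate : ∀ ys {zs} → AllTriples P (ys ++ zs) → AllTriples P (zs ++ ys)
  rotate []       {zs} ts       = subst (AllTriples P) (sym (++-identityʳ zs)) ts
  rotate (y ∷ ys) {zs} (t ∷ ts) = subst (AllTriples P) (++-assoc zs [ y ] ys)
    (rotate ys (subst (AllTriples P) (++-assoc ys zs [ y ])
      (AllTriples-∷ʳ ts (AllPairs.map cyclic t))))

  ∈-rotations⁻ : ∀ {D π} → Decreasing D → π ∈ rotations D → π ↭ D × AllTriples P π
  ∈-rotations⁻ {D} dec π∈ with ∈-map⁻ (λ k → rotation k D) π∈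
  ... | k , _ , refl = rotation-↭ k D , rotate (take k D)
    (subst (AllTriples P) (sym (take++drop≡id k D)) (decreasing⇒AllTriples decreasing dec))

  -- Rotate the decreasing word until it starts with the first entry h of π. By `rotate` its tail is
  -- sorted by `P h`, as is that of π, and `ascent` makes `P h` antisymmetric on entries other than
  -- h, so the tails coincide.
  ∈-rotations⁺ : ∀ {d D π} → Decreasing (d ∷ D) → π ↭ d ∷ D → AllTriples P π → π ∈ rotations (d ∷ D)
  ∈-rotations⁺ {π = []}    _   p _ = contradiction (↭-length p) λ ()
  ∈-rotations⁺ {d} {D} {h ∷ π} dec p (t ∷ ts) with ∈-∃++ (∈-resp-↭ p (here refl))
  ... | ys , zs , D≡ = subst (λ D → h ∷ π ∈ rotations D) (sym D≡)
    (subst (_∈ rotations (ys ++ h ∷ zs)) (trans (rotation-length ys) (sym (cong (h ∷_) π≡)))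
      (∈-map⁺ (λ k → rotation k (ys ++ h ∷ zs)) (∈-upTo⁺ ys<D)))
    where
    ys<D : length ys < length (ys ++ h ∷ zs)
    ys<D = subst (length ys <_) (sym (length-++ ys)) (m<m+n (length ys) z<s)

    D↭ : d ∷ D ↭ h ∷ zs ++ ys
    D↭ = ↭-trans (↭-reflexive D≡) (++-comm ys (h ∷ zs))

    h≢ : All (h ≢_) (zs ++ ys)
    h≢ = AllPairs.head (Permutation.Unique-resp-↭ (setoid ℕ) (↭⇒↭ₛ D↭) (AllPairs.map >⇒≢ dec))

    ordered : AllTriples P (h ∷ zs ++ ys)
    ordered = rotate ys (subst (AllTriples P) D≡ (decreasing⇒AllTriples decreasing dec))

    anti : ∀ {x y} → x ∈ zs ++ ys → y ∈ zs ++ ys → P h x y → P h y x → x ≡ y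
    anti {x} {y} x∈ y∈ hxy hyx with <-cmp x y
    ... | tri< x<y _ _ = contradiction hyx (ascent (All.lookup h≢ x∈) (All.lookup h≢ y∈) x<y hxy)
    ... | tri≈ _ x≡y _ = x≡y
    ... | tri> _ _ y<x = contradiction hxy (ascent (All.lookup h≢ y∈) (All.lookup h≢ x∈) y<x hyx)

    π≡ : π ≡ zs ++ ys
    π≡ with ordered
    ... | o ∷ _ = ordered-unique anti t o (drop-∷ (↭-trans p D↭))

  ∈-rotations⇔ : ∀ {d D} → Decreasing (d ∷ D) →
                 ∀ {π} → (π ∈ rotations (d ∷ D)) ⇔ (π ↭ d ∷ D × AllTriples P π)
  ∈-rotations⇔ dec = mk⇔ (∈-rotations⁻ dec) (λ (p , ts) → ∈-rotations⁺ dec p ts)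

-- The three avoidance classes

pattern123 : Pattern 1 2 3 0F 1F 2F
pattern123 = record { low = ≤-refl ; high = ≤-refl ; cover = λ
  { 0F → inj₁ refl ; 1F → inj₂ (inj₁ refl) ; 2F → inj₂ (inj₂ refl) } }

pattern132 : Pattern 1 3 2 0F 2F 1F
pattern132 = record { low = ≤-refl ; high = ≤-refl ; cover = λ
  { 0F → inj₁ refl ; 1F → inj₂ (inj₂ refl) ; 2F → inj₂ (inj₁ refl) } }

pattern213 : Pattern 2 1 3 1F 0F 2F
pattern213 = record { low = ≤-refl ; high = ≤-refl ; cover = λ
  { 0F → inj₂ (inj₁ refl) ; 1F → inj₁ refl ; 2F → inj₂ (inj₂ refl) } }

pattern231 : Pattern 2 3 1 2F 0F 1F
pattern231 = record { low = ≤-refl ; high = ≤-refl ; cover = λ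
  { 0F → inj₂ (inj₁ refl) ; 1F → inj₂ (inj₂ refl) ; 2F → inj₁ refl } }

pattern312 : Pattern 3 1 2 1F 2F 0F
pattern312 = record { low = ≤-refl ; high = ≤-refl ; cover = λ
  { 0F → inj₂ (inj₂ refl) ; 1F → inj₁ refl ; 2F → inj₂ (inj₁ refl) } }

module _ {a₁ b₁ c₁ a₂ b₂ c₂ a₃ b₃ c₃ u₁ v₁ w₁ u₂ v₂ w₂ u₃ v₃ w₃}
         (pat₁ : Pattern a₁ b₁ c₁ u₁ v₁ w₁)
         (pat₂ : Pattern a₂ b₂ c₂ u₂ v₂ w₂)
         (pat₃ : Pattern a₃ b₃ c₃ u₃ v₃ w₃) where

  AvoidEach : ℕ → ℕ → ℕ → Set
  AvoidEach x y z = Avoid u₁ v₁ w₁ x y z × Avoid u₂ v₂ w₂ x y z × Avoid u₃ v₃ w₃ x y z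

  -- D may be any arrangement of 1 ... n; each class takes the one from which its avoiders are
  -- built.
  pf-count₃ : ∀ {n D πs} → D ↭ ⟦1⋯ n ⟧ →
    (∀ {π} → (π ∈ πs) ⇔ (π ↭ D × AllTriples AvoidEach π)) →
    map (length ∘ paths) πs ↭ ⟦1⋯ n ⟧ →
    pf n ((a₁ ∷ b₁ ∷ c₁ ∷ []) ∷ (a₂ ∷ b₂ ∷ c₂ ∷ []) ∷ (a₃ ∷ b₃ ∷ c₃ ∷ []) ∷ []) ≡ (n + 1) C 2
  pf-count₃ {n} {πs = πs} D↭ πs⇔ = pf-count n _ πs (mk⇔
    (λ π∈ → let p , ts = Equivalence.to πs⇔ π∈ in
      ↭-trans p D↭ ,
      avoids⁺ pat₁ (AllTriples-map proj₁ ts) ∷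
      avoids⁺ pat₂ (AllTriples-map (proj₁ ∘ proj₂) ts) ∷
      avoids⁺ pat₃ (AllTriples-map (proj₂ ∘ proj₂) ts) ∷ [])
    (λ { (p , av₁ ∷ av₂ ∷ av₃ ∷ []) → Equivalence.from πs⇔ (↭-trans p (↭-sym D↭) ,
      AllTriples-zip (avoids⁻ pat₁ av₁) (AllTriples-zip (avoids⁻ pat₂ av₂) (avoids⁻ pat₃ av₃))) }))

-- `not-low` and `not-high` refute an occurrence in `Avoid` at its lower or its upper inequality.
not-low : ∀ {x y} {A : Set} → x > y → ¬ (x < y × A)
not-low x>y (x<y , _) = <-asym x<y x>y

not-high : ∀ {x y} {A : Set} → x > y → ¬ (A × x < y)
not-high x>y (_ , x<y) = <-asym x<y x>y

-- The avoiders are m … 1 with the entry m + 1 inserted anywhere.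
pf-123-132-312 : ∀ m → pf (suc m) ((1 ∷ 2 ∷ 3 ∷ []) ∷ (1 ∷ 3 ∷ 2 ∷ []) ∷ (3 ∷ 1 ∷ 2 ∷ []) ∷ [])
                       ≡ (suc m + 1) C 2
pf-123-132-312 m = pf-count₃ pattern123 pattern132 pattern312
  (applyDownFrom↭applyUpTo suc (suc m))
  (∈-insertions⇔ (_< suc m) (<-irrefl refl)
    (λ x>y y>z → not-low x>y , not-low (<-trans y>z x>y) , not-low y>z)
    (λ y<m z<m y>z → (not-low y<m  , not-low z<m  , not-low y>z)
                   , (not-high z<m , not-low y>z  , not-low z<m)
                   , (not-low y>z  , not-high z<m , not-high y<m))
    (λ _ z<m y<z → (λ (_ , _ , ¬312) → ¬312 (y<z , z<m))
                 , (λ (_ , ¬132 , _) → ¬132 (y<z , z<m))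
                 , (λ (¬123 , _ , _) → ¬123 (y<z , z<m)))
    dec <m)
  (subst (λ k → map (length ∘ paths) (insertions (suc m) D) ↭ ⟦1⋯ suc k ⟧)
    (length-applyDownFrom suc m) (#paths-insertions-max D dec <m))
  where
  D : List ℕ
  D = applyDownFrom suc m

  dec : Decreasing D
  dec = AllPairs.applyDownFrom⁺₁ suc m (λ j<i _ → s<s j<i)

  <m : All (_< suc m) D
  <m = All.applyDownFrom⁺₁ suc m s<s

-- The avoiders are m + 1 … 2 with the entry 1 inserted anywhere.
pf-123-213-231 : ∀ m → pf (suc m) ((1 ∷ 2 ∷ 3 ∷ []) ∷ (2 ∷ 1 ∷ 3 ∷ []) ∷ (2 ∷ 3 ∷ 1 ∷ []) ∷ [])
                       ≡ (suc m + 1) C 2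
pf-123-213-231 m = pf-count₃ pattern123 pattern213 pattern231
  (↭-prep 1 (applyDownFrom↭applyUpTo (2 +_) m))
  (∈-insertions⇔ (1 <_) (<-irrefl refl)
    (λ x>y y>z → not-low x>y , not-high (<-trans y>z x>y) , not-high x>y)
    (λ 1<y 1<z y>z → (not-high y>z , not-low 1<y  , not-low 1<z)
                   , (not-low 1<y  , not-high y>z , not-high 1<y)
                   , (not-low y>z  , not-high 1<y , not-high y>z))
    (λ 1<y _ y<z → (λ (¬123 , _ , _) → ¬123 (1<y , y<z))
                 , (λ (_ , ¬213 , _) → ¬213 (1<y , y<z))
                 , (λ (_ , _ , ¬231) → ¬231 (1<y , y<z)))
    dec 1<)
  (begin
    map (length ∘ paths) (insertions 1 D) ≡⟨ #paths-insertions-min D dec 1< ⟩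
    applyDownFrom suc (suc (length D))    ≡⟨ cong (applyDownFrom suc ∘ suc) (length-applyDownFrom (2 +_) m) ⟩
    applyDownFrom suc (suc m)             ↭⟨ applyDownFrom↭applyUpTo suc (suc m) ⟩
    ⟦1⋯ suc m ⟧                           ∎)
  where
  open PermutationReasoning

  D : List ℕ
  D = applyDownFrom (2 +_) m

  dec : Decreasing D
  dec = AllPairs.applyDownFrom⁺₁ (2 +_) m (λ j<i _ → s<s (s<s j<i))

  1< : All (1 <_) D
  1< = All.applyDownFrom⁺₂ (2 +_) m (λ _ → s<s z<s)

-- 123, 231 and 312 are the cyclically increasing triples, so the avoiders are
-- the rotations of m + 1 … 1.
pf-123-231-312 : ∀ m → pf (suc m) ((1 ∷ 2 ∷ 3 ∷ []) ∷ (2 ∷ 3 ∷ 1 ∷ []) ∷ (3 ∷ 1 ∷ 2 ∷ []) ∷ [])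
                       ≡ (suc m + 1) C 2
pf-123-231-312 m = pf-count₃ pattern123 pattern231 pattern312
  (applyDownFrom↭applyUpTo suc (suc m))
  (∈-rotations⇔
    (λ (¬123 , ¬231 , ¬312) → ¬312 , ¬123 , ¬231)
    (λ x>y y>z → not-low x>y , not-high x>y , not-low y>z)
    -- As x, y, z is neither a 123 nor a 312, x lies strictly between y and z, and then x, z, y is a
    -- 231.
    (λ { x≢y x≢z y<z (¬x<y<z , _ , ¬y<z<x) (_ , ¬y<x<z , _) → ¬y<x<z
         ( ≤∧≢⇒< (≮⇒≥ λ x<y → ¬x<y<z (x<y , y<z)) (x≢y ∘ sym)
         , ≤∧≢⇒< (≮⇒≥ λ z<x → ¬y<z<x (y<z , z<x)) x≢z) })
    dec)
  (↭-reflexive (trans (#paths-rotations dec) (cong ⟦1⋯_⟧ (length-applyDownFrom suc (suc m)))))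
  where
  dec : Decreasing (applyDownFrom suc (suc m))
  dec = AllPairs.applyDownFrom⁺₁ suc (suc m) (λ j<i _ → s<s j<i)

theorem9 : (n : ℕ) → n ≥ 1 →
  (pf n ((1 ∷ 2 ∷ 3 ∷ []) ∷ (1 ∷ 3 ∷ 2 ∷ []) ∷ (3 ∷ 1 ∷ 2 ∷ []) ∷ [])
    ≡ pf n ((1 ∷ 2 ∷ 3 ∷ []) ∷ (2 ∷ 1 ∷ 3 ∷ []) ∷ (2 ∷ 3 ∷ 1 ∷ []) ∷ []))
  × (pf n ((1 ∷ 2 ∷ 3 ∷ []) ∷ (2 ∷ 1 ∷ 3 ∷ []) ∷ (2 ∷ 3 ∷ 1 ∷ []) ∷ [])
    ≡ pf n ((1 ∷ 2 ∷ 3 ∷ []) ∷ (2 ∷ 3 ∷ 1 ∷ []) ∷ (3 ∷ 1 ∷ 2 ∷ []) ∷ []))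
  × (pf n ((1 ∷ 2 ∷ 3 ∷ []) ∷ (2 ∷ 3 ∷ 1 ∷ []) ∷ (3 ∷ 1 ∷ 2 ∷ []) ∷ [])
    ≡ (n + 1) C 2)
theorem9 (suc m) _ =
  trans (pf-123-132-312 m) (sym (pf-123-213-231 m)) ,
  trans (pf-123-213-231 m) (sym (pf-123-231-312 m)) ,
  pf-123-231-312 m
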